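{- Let $n$ be an integer with $n = 5$ or $n \ge 7$, and let $G$ be the finite simple undirected graph with $2n+4$ pairwise distinct vertices $$V(G) = \{a_1, a_2, a_3, b_1, b_2, \dots, b_{n+1}, c_1, c_2, \dots, c_{n-1}, d\}$$ whose edge set is defined, according to the parity of $n$, as follows. If $n$ is odd (so $n \ge 5$): \begin{align*} E(G) &= \{a_i b_j \mid i \le j,\ 1 \le i \le 3,\ 1 \le j \le n+1\} \\ &\quad \cup \{b_j b_l \mid 1 \le j < l \le n+1\} \\ &\quad \cup \{b_j c_k \mid 1 \le k \le n-1,\ 1 \le j \le n,\ k \le j+1\} \\ &\quad \cup \{c_k c_m \mid 1 \le k < m \le n-1\} \\ &\quad \cup \{b_j d \mid 2 \le j \le n-1\} \cup \{a_3 c_{n-1},\ a_2 d\}. \end{align*} If $n$ is even (so $n \ge 8$): \begin{align*} E(G) &= \{a_i b_j \mid i \le j,\ 1 \le i \le 3,\ 1 \le j \le n+1\} \\ &\quad \cup \{b_j b_l \mid 1 \le j < l \le n+1\} \\ &\quad \cup \{b_j c_k \mid 1 \le k \le n-1,\ 1 \le j \le n,\ 1 \le k \le j+1\} \\ &\quad \cup \{c_k c_m \mid 1 \le k < m \le n-1\} \\ &\quad \cup \{b_j d \mid 2 \le j \le n-3\} \cup \{a_3 c_{n-1},\ a_1 d,\ a_2 d,\ b_{n+1} d\}. \end{align*} Then $G$ is not $K_n$-irregular.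
   Context: $K_n$ denotes the complete graph of order $n$, and $uv$ denotes the undirected edge joining vertices $u$ and $v$. For a fixed graph $F$, the $F$-degree of a vertex $v$ in a graph $G$ is the number of subgraphs of $G$ isomorphic to $F$ that contain $v$. A graph $G$ is called $F$-irregular if all its vertices have pairwise distinct $F$-degrees. -}

module Defs where

open import Level using (0ℓ)
open import Data.Bool.Base using (Bool; true; false; T)
open import Data.Bool.Properties using (T-irrelevant; T?) renaming (_≟_ to _≟ᵇ_)
open import Data.Empty using (⊥-elim)
open import Data.Fin.Base using (Fin; zero; suc; toℕ; combine; funToFin; finToFun)
open import Data.Fin.Properties using (_≟_; any?; suc-injective; funToFin-finToFin; finToFun-funToFin; 2↔Bool; *↔×; +↔⊎; 1↔⊤)
open import Data.Nat.Base using (ℕ; zero; suc; _+_; _*_; _∸_; _^_; _≤_; _<_; parity)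
import Data.Nat.Properties as ℕ
open import Data.Parity.Base using (0ℙ; 1ℙ)
import Data.Parity.Properties as ℙ
open import Data.Product.Base using (Σ; Σ-syntax; ∃; _×_; _,_; proj₁; proj₂; uncurry; curry)
open import Data.Product.Function.NonDependent.Setoid using (_×-inverse_)
open import Data.Product.Function.NonDependent.Propositional using (_×-↔_)
open import Data.Product.Relation.Binary.Pointwise.NonDependent using (_×ₛ_)
open import Data.Sum.Base using (_⊎_; inj₁; inj₂; [_,_]′)
open import Data.Sum.Function.Propositional using (_⊎-↔_)
open import Data.Unit.Base using (⊤; tt)
open import Function.Base using (_∘_; id; case_of_)
open import Function.Bundles using (Inverse; _↔_; mk↔ₛ′; _⇔_; mk⇔; Equivalence)
open import Function.Construct.Composition using (_↔-∘_; _⇔-∘_) renaming (inverse to infixl 9 _⨾_)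
import Function.Construct.Identity as Id
open import Function.Construct.Symmetry using (↔-sym)
open import Relation.Binary.Bundles using (Setoid)
open import Relation.Binary.Core using (Rel)
open import Relation.Binary.Definitions using (Symmetric; Irreflexive) renaming (Decidable to Decidable₂)
import Relation.Binary.Construct.On as On
open import Relation.Binary.Construct.Closure.Symmetric using (SymClosure; fwd; bwd; symmetric)
open import Relation.Binary.PropositionalEquality using (_≡_; _≢_; refl; sym; trans; cong; cong₂; subst; setoid; _→-setoid_; _≗_)
open import Relation.Nullary using (¬_; Dec; yes; no)
open import Relation.Nullary.Decidable using (map′; _×-dec_; _⊎-dec_; _→-dec_; ¬?; decidable-stable)
open import Relation.Unary using (Decidable)

------------------------------------------------------------------------
-- Finite setoids

HasCardinality : Setoid 0ℓ 0ℓ → ℕ → Set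
HasCardinality S k = Inverse S (setoid (Fin k))

Finite : Setoid 0ℓ 0ℓ → Set
Finite S = ∃ (HasCardinality S)

open Setoid using (Carrier)

Respects : (S : Setoid 0ℓ 0ℓ) → (Carrier S → Set) → Set
Respects S P = ∀ {x y} → Setoid._≈_ S x y → P x → P y

_∣ₛ_ : (S : Setoid 0ℓ 0ℓ) → (Carrier S → Set) → Setoid 0ℓ 0ℓ
S ∣ₛ P = On.setoid {B = Σ (Carrier S) P} S proj₁

private
  mkInverse : (S R : Setoid 0ℓ 0ℓ) (f : Carrier S → Carrier R) (g : Carrier R → Carrier S) →
              (∀ {x y} → Setoid._≈_ S x y → Setoid._≈_ R (f x) (f y)) →
              (∀ {x y} → Setoid._≈_ R x y → Setoid._≈_ S (g x) (g y)) →
              (∀ y → Setoid._≈_ R (f (g y)) y) → (∀ x → Setoid._≈_ S (g (f x)) x) →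
              Inverse S R
  mkInverse S R f g f-cong g-cong fg gf = record
    { to = f ; from = g ; to-cong = f-cong ; from-cong = g-cong
    ; inverse = (λ p → Setoid.trans R (f-cong p) (fg _)) , (λ p → Setoid.trans S (g-cong p) (gf _)) }

  finite-transport : ∀ {S R} → Inverse S R → Finite R → Finite S
  finite-transport i (k , j) = k , (i ⨾ j)

  finite-× : ∀ {S R} → Finite S → Finite R → Finite (S ×ₛ R)
  finite-× (k , i) (l , j) = k * l , (i ×-inverse j) ⨾
    mkInverse (setoid (Fin k) ×ₛ setoid (Fin l)) (setoid (Fin (k * l)))
      (Inverse.from *↔×) (Inverse.to *↔×)
      (λ { (refl , refl) → refl }) (λ { refl → refl , refl })
      (Inverse.strictlyInverseʳ (*↔× {k} {l})) (λ x → case Inverse.strictlyInverseˡ (*↔× {k} {l}) x of λ e → cong proj₁ e , cong proj₂ e)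

  funToFin-cong : ∀ {m n} {f g : Fin m → Fin n} → f ≗ g → funToFin f ≡ funToFin g
  funToFin-cong {zero}  e = refl
  funToFin-cong {suc m} e = cong₂ combine (e zero) (funToFin-cong (e ∘ suc))

  finite-→ : ∀ {A B : Set} → Finite (setoid A) → Finite (setoid B) → Finite (A →-setoid B)
  finite-→ {A} {B} (m , i) (n , j) = n ^ m , mkInverse (A →-setoid B) (setoid _)
    (λ f → funToFin (J.to ∘ f ∘ I.from))
    (λ k a → J.from (finToFun k (I.to a)))
    (λ e → funToFin-cong (λ x → cong J.to (e (I.from x))))
    (λ { refl _ → refl })
    (λ k → trans
      (funToFin-cong λ x → trans (J.strictlyInverseˡ _) (cong (finToFun k) (I.strictlyInverseˡ x)))
      (funToFin-finToFin {m} {n} k))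
    (λ f a → trans
      (cong J.from (finToFun-funToFin (J.to ∘ f ∘ I.from) (I.to a)))
      (trans (J.strictlyInverseʳ _) (cong f (I.strictlyInverseʳ a))))
    where module I = Inverse i
          module J = Inverse j

  finite-Fin-∣ : ∀ k {P : Fin k → Set} → Decidable P → Finite (setoid (Fin k) ∣ₛ P)
  finite-Fin-∣ zero P? = 0 , mkInverse _ (setoid (Fin 0)) (λ ()) (λ ()) (λ { {() , _} }) (λ { {()} }) (λ ()) (λ ())
  finite-Fin-∣ (suc k) {P} P? with P? zero | finite-Fin-∣ k (P? ∘ suc)
  ... | yes p | l , i = suc l , mkInverse (setoid (Fin (suc k)) ∣ₛ P) (setoid (Fin (suc l)))
      f g (λ {x} {y} → f-cong {x} {y}) (λ { refl → refl }) fg gf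
    where
      module I = Inverse i
      f : Σ (Fin (suc k)) P → Fin (suc l)
      f (zero  , _) = zero
      f (suc x , q) = suc (I.to (x , q))
      g : Fin (suc l) → Σ (Fin (suc k)) P
      g zero    = zero , p
      g (suc y) = suc (proj₁ (I.from y)) , proj₂ (I.from y)
      f-cong : ∀ {x y} → proj₁ x ≡ proj₁ y → f x ≡ f y
      f-cong {zero  , _} {zero  , _} e = refl
      f-cong {suc x , _} {suc y , _} e = cong suc (I.to-cong (suc-injective e))
      fg : ∀ y → f (g y) ≡ y
      fg zero    = refl
      fg (suc y) = cong suc (I.strictlyInverseˡ y)
      gf : ∀ x → proj₁ (g (f x)) ≡ proj₁ x
      gf (zero  , _) = refl
      gf (suc x , q) = cong suc (I.strictlyInverseʳ (x , q))
  ... | no ¬p | l , i = l , mkInverse (setoid (Fin (suc k)) ∣ₛ P) (setoid (Fin l))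
      f g (λ {x} {y} → f-cong {x} {y}) (λ { refl → refl }) I.strictlyInverseˡ gf
    where
      module I = Inverse i
      f : Σ (Fin (suc k)) P → Fin l
      f (zero  , p) = ⊥-elim (¬p p)
      f (suc x , q) = I.to (x , q)
      g : Fin l → Σ (Fin (suc k)) P
      g y = suc (proj₁ (I.from y)) , proj₂ (I.from y)
      f-cong : ∀ {x y} → proj₁ x ≡ proj₁ y → f x ≡ f y
      f-cong {zero  , p} e = ⊥-elim (¬p p)
      f-cong {suc x , _} {suc y , _} e = I.to-cong (suc-injective e)
      gf : ∀ x → proj₁ (g (f x)) ≡ proj₁ x
      gf (zero  , p) = ⊥-elim (¬p p)
      gf (suc x , q) = cong suc (I.strictlyInverseʳ (x , q))

  finite-∣ : ∀ {S P} → Finite S → Respects S P → Decidable P → Finite (S ∣ₛ P)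
  finite-∣ {S} {P} (k , i) resp P? = finite-transport
    (mkInverse (S ∣ₛ P) (setoid (Fin k) ∣ₛ (P ∘ I.from))
      (λ (x , p) → I.to x , resp (Setoid.sym S (I.strictlyInverseʳ x)) p)
      (λ (y , p) → I.from y , p)
      I.to-cong I.from-cong (λ (y , _) → I.strictlyInverseˡ y) (λ (x , _) → I.strictlyInverseʳ x))
    (finite-Fin-∣ k (P? ∘ I.from))
    where module I = Inverse i

  ∃? : ∀ {S P} → Finite S → Respects S P → Decidable P → Dec (∃ P)
  ∃? {S} (k , i) resp P? = map′ (λ (y , p) → I.from y , p)
    (λ (x , p) → I.to x , resp (Setoid.sym S (I.strictlyInverseʳ x)) p) (any? (P? ∘ I.from))
    where module I = Inverse i

  ∀? : ∀ {A : Set} {P : A → Set} → Finite (setoid A) → Decidable P → Dec (∀ x → P x)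
  ∀? fin P? = map′ (λ ¬∃ x → decidable-stable (P? x) (λ ¬p → ¬∃ (x , ¬p))) (λ all (x , ¬p) → ¬p (all x))
    (¬? (∃? fin (λ { refl p → p }) (¬? ∘ P?)))

  ≡? : ∀ {A : Set} → Finite (setoid A) → Decidable₂ (_≡_ {A = A})
  ≡? (k , i) x y = map′ (λ e → trans (sym (I.strictlyInverseʳ x)) (trans (cong I.from e) (I.strictlyInverseʳ y)))
    (cong I.to) (I.to x ≟ I.to y)
    where module I = Inverse i

  finite-Bool : Finite (setoid Bool)
  finite-Bool = 2 , ↔-sym 2↔Bool

  finite-ΣT : ∀ {A : Set} → Finite (setoid A) → (p : A → Bool) → Finite (setoid (Σ A (T ∘ p)))
  finite-ΣT {A} fin p = finite-transport
    (mkInverse (setoid (Σ A (T ∘ p))) (setoid A ∣ₛ (T ∘ p)) id id (cong proj₁) ext (λ _ → refl) (λ _ → refl))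
    (finite-∣ fin (λ { refl q → q }) (T? ∘ p))
    where
      ext : ∀ {x y : Σ A (T ∘ p)} → proj₁ x ≡ proj₁ y → x ≡ y
      ext {x , q} {_ , r} refl = cong (x ,_) (T-irrelevant q r)

------------------------------------------------------------------------
-- Graphs

record Graph : Set₁ where
  field
    Vertex     : Set
    Adj        : Rel Vertex 0ℓ
    Adj-sym    : Symmetric Adj
    Adj-irrefl : Irreflexive _≡_ Adj

record FiniteGraph : Set₁ where
  field
    graph           : Graph
    finite-vertices : Finite (setoid (Graph.Vertex graph))
    adj?            : Decidable₂ (Graph.Adj graph)
  open Graph graph public

record _≅_ (G H : Graph) : Set where
  private
    module G = Graph G
    module H = Graph H
  field
    bijection : G.Vertex ↔ H.Vertex
    adj-iff   : ∀ u v → G.Adj u v ⇔ H.Adj (Inverse.to bijection u) (Inverse.to bijection v)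

-- A subgraph is a vertex set together with a set of edges of the ambient graph
-- with both ends in it; it need not be an induced subgraph. The vertex and edge
-- sets are Boolean-valued, and the edge set is a symmetric relation, so that
-- each subgraph of a finite graph is represented exactly once up to _≈_ below.
record Subgraph (G : Graph) : Set where
  open Graph G
  field
    inV     : Vertex → Bool
    inE     : Vertex → Vertex → Bool
    inE-sym : ∀ u v → inE u v ≡ inE v u
    inE-Adj : ∀ u v → T (inE u v) → Adj u v
    inE-inV : ∀ u v → T (inE u v) → T (inV u)

  asGraph : Graph
  asGraph = record
    { Vertex     = Σ[ v ∈ Vertex ] T (inV v)
    ; Adj        = λ u v → T (inE (proj₁ u) (proj₁ v))
    ; Adj-sym    = λ {u} {v} → subst T (inE-sym (proj₁ u) (proj₁ v))
    ; Adj-irrefl = λ { refl e → Adj-irrefl refl (inE-Adj _ _ e) }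
    }

open Subgraph using (inV; inE; asGraph)

-- Two subgraphs are equal when they have the same vertices and the same edges.
subgraphSetoid : Graph → Setoid 0ℓ 0ℓ
subgraphSetoid G = record
  { Carrier = Subgraph G
  ; _≈_     = λ H K → (∀ v → inV H v ≡ inV K v) × (∀ u v → inE H u v ≡ inE K u v)
  ; isEquivalence = record
    { refl  = (λ _ → refl) , (λ _ _ → refl)
    ; sym   = λ (p , q) → (λ v → sym (p v)) , (λ u v → sym (q u v))
    ; trans = λ (p , q) (r , s) → (λ v → trans (p v) (r v)) , (λ u v → trans (q u v) (s u v))
    }
  }

IsCopyThrough : (F G : Graph) → Graph.Vertex G → Subgraph G → Set
IsCopyThrough F G v H = T (inV H v) × (asGraph H ≅ F)

copiesThrough : (F G : Graph) → Graph.Vertex G → Setoid 0ℓ 0ℓ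
copiesThrough F G v = subgraphSetoid G ∣ₛ IsCopyThrough F G v

private
  ≅-trans : ∀ {G H K} → G ≅ H → H ≅ K → G ≅ K
  ≅-trans p q = record
    { bijection = _≅_.bijection q ↔-∘ _≅_.bijection p
    ; adj-iff   = λ u v → _≅_.adj-iff q _ _ ⇔-∘ _≅_.adj-iff p u v
    }

  ≈⇒≅ : ∀ {G H K} → Setoid._≈_ (subgraphSetoid G) H K → asGraph H ≅ asGraph K
  ≈⇒≅ {H = H} {K} (p , q) = record
    { bijection = mk↔ₛ′
        (λ (v , h) → v , subst T (p v) h) (λ (v , h) → v , subst T (sym (p v)) h)
        (λ (v , h) → cong (v ,_) (T-irrelevant _ h)) (λ (v , h) → cong (v ,_) (T-irrelevant _ h))
    ; adj-iff = λ (u , _) (v , _) → mk⇔ (subst T (q u v)) (subst T (sym (q u v)))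
    }

  module _ (G H : FiniteGraph) where
    private
      module G = FiniteGraph G
      module H = FiniteGraph H

    IsIso : (G.Vertex → H.Vertex) × (H.Vertex → G.Vertex) → Set
    IsIso (f , g) = (∀ y → f (g y) ≡ y) × (∀ x → g (f x) ≡ x) ×
      (∀ u v → G.Adj u v → H.Adj (f u) (f v)) × (∀ u v → H.Adj (f u) (f v) → G.Adj u v)

    fromIso : G.graph ≅ H.graph → ∃ IsIso
    fromIso i = (I.to , I.from) , I.strictlyInverseˡ , I.strictlyInverseʳ ,
      (λ u v → Equivalence.to (_≅_.adj-iff i u v)) , (λ u v → Equivalence.from (_≅_.adj-iff i u v))
      where module I = Inverse (_≅_.bijection i)

    ≅? : Dec (G.graph ≅ H.graph)
    ≅? = map′
      (λ ((f , g) , fg , gf , p , q) → record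
        { bijection = mk↔ₛ′ f g fg gf ; adj-iff = λ u v → mk⇔ (p u v) (q u v) })
      fromIso
      (∃? {P = IsIso} (finite-× (finite-→ G.finite-vertices H.finite-vertices) (finite-→ H.finite-vertices G.finite-vertices))
        (λ { {f , g} {f′ , g′} (ef , eg) (fg , gf , p , q) →
          (λ y → trans (trans (sym (ef (g′ y))) (cong f (sym (eg y)))) (fg y)) ,
          (λ x → trans (trans (sym (eg (f′ x))) (cong g (sym (ef x)))) (gf x)) ,
          (λ u v a → subst (λ w → H.Adj w (f′ v)) (ef u) (subst (H.Adj (f u)) (ef v) (p u v a))) ,
          (λ u v a → q u v (subst (λ w → H.Adj w (f v)) (sym (ef u)) (subst (H.Adj (f′ u)) (sym (ef v)) a))) })
        (λ (f , g) →
          ∀? H.finite-vertices (λ y → ≡? H.finite-vertices (f (g y)) y) ×-dec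
          ∀? G.finite-vertices (λ x → ≡? G.finite-vertices (g (f x)) x) ×-dec
          ∀? G.finite-vertices (λ u → ∀? G.finite-vertices (λ v → G.adj? u v →-dec H.adj? (f u) (f v))) ×-dec
          ∀? G.finite-vertices (λ u → ∀? G.finite-vertices (λ v → H.adj? (f u) (f v) →-dec G.adj? u v))))

  module _ (G : FiniteGraph) where
    open FiniteGraph G

    Code : Setoid 0ℓ 0ℓ
    Code = (Vertex →-setoid Bool) ×ₛ ((Vertex × Vertex) →-setoid Bool)

    IsCode : Carrier Code → Set
    IsCode (p , q) = (∀ u v → q (u , v) ≡ q (v , u)) ×
      (∀ u v → T (q (u , v)) → Adj u v) × (∀ u v → T (q (u , v)) → T (p u))

    code? : Decidable IsCode
    code? (p , q) =
      ∀? finite-vertices (λ u → ∀? finite-vertices (λ v → q (u , v) ≟ᵇ q (v , u))) ×-dec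
      ∀? finite-vertices (λ u → ∀? finite-vertices (λ v → T? (q (u , v)) →-dec adj? u v)) ×-dec
      ∀? finite-vertices (λ u → ∀? finite-vertices (λ v → T? (q (u , v)) →-dec T? (p u)))

    IsCode-resp : Respects Code IsCode
    IsCode-resp (ep , eq) (s , a , i) =
      (λ u v → trans (sym (eq (u , v))) (trans (s u v) (eq (v , u)))) ,
      (λ u v t → a u v (subst T (sym (eq (u , v))) t)) ,
      (λ u v t → subst T (ep u) (i u v (subst T (sym (eq (u , v))) t)))

    finite-pairs : Finite (setoid (Vertex × Vertex))
    finite-pairs = let k , i = finite-vertices in k * k , ↔-sym *↔× ↔-∘ (i ×-↔ i)

    finite-Subgraph : Finite (subgraphSetoid graph)
    finite-Subgraph = finite-transport
      (mkInverse (subgraphSetoid graph) (Code ∣ₛ IsCode)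
        (λ H → (inV H , uncurry (inE H)) , Subgraph.inE-sym H , Subgraph.inE-Adj H , Subgraph.inE-inV H)
        (λ ((p , q) , s , a , i) → record
          { inV = p ; inE = curry q ; inE-sym = s ; inE-Adj = a ; inE-inV = i })
        (λ (p , q) → p , uncurry q) (λ (p , q) → p , curry q)
        (λ _ → (λ _ → refl) , (λ _ → refl)) (λ _ → (λ _ → refl) , (λ _ _ → refl)))
      (finite-∣ (finite-× (finite-→ finite-vertices finite-Bool) (finite-→ finite-pairs finite-Bool))
        IsCode-resp code?)

    asFiniteGraph : Subgraph graph → FiniteGraph
    asFiniteGraph H = record
      { graph           = asGraph H
      ; finite-vertices = finite-ΣT finite-vertices (inV H)
      ; adj?            = λ _ _ → T? _
      }

copies-finite : (F G : FiniteGraph) (v : FiniteGraph.Vertex G) →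
                Finite (copiesThrough (FiniteGraph.graph F) (FiniteGraph.graph G) v)
copies-finite F G v = finite-∣ (finite-Subgraph G)
  (λ {H} {H′} e (t , i) → subst T (proj₁ e v) t , ≅-trans (≈⇒≅ {H = H′} {H} (Setoid.sym (subgraphSetoid _) {H} {H′} e)) i)
  (λ H → T? _ ×-dec ≅? (asFiniteGraph G H) F)

------------------------------------------------------------------------
-- F-degrees and F-irregular graphs

degree : (F G : FiniteGraph) → FiniteGraph.Vertex G → ℕ
degree F G v = proj₁ (copies-finite F G v)

Irregular : (F G : FiniteGraph) → Set
Irregular F G = ∀ u v → u ≢ v → degree F G u ≢ degree F G v

K : ℕ → FiniteGraph
K n = record
  { graph = record
    { Vertex     = Fin n
    ; Adj        = _≢_
    ; Adj-sym    = λ p → p ∘ sym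
    ; Adj-irrefl = λ e p → p e
    }
  ; finite-vertices = n , Id.↔-id _
  ; adj?            = λ u v → ¬? (u ≟ v)
  }

------------------------------------------------------------------------
-- The graph on {a₁,a₂,a₃, b₁,…,bₙ₊₁, c₁,…,cₙ₋₁, d}

data V (n : ℕ) : Set where
  a : Fin 3       → V n
  b : Fin (suc n) → V n
  c : Fin (n ∸ 1) → V n
  d : V n

-- Fin counts from 0, the indices of the vertices from 1: b i is the vertex
-- b_(ix i).
ix : ∀ {m} → Fin m → ℕ
ix i = suc (toℕ i)

-- The edges in the orientation in which they are listed. For odd n (parity 1ℙ)
-- and even n (parity 0ℙ) only the edges at d differ.
data Edge (n : ℕ) : Rel (V n) 0ℓ where
  ab   : ∀ {i j} → ix i ≤ ix j → Edge n (a i) (b j)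
  bb   : ∀ {j l} → ix j < ix l → Edge n (b j) (b l)
  bc   : ∀ {j k} → ix j ≤ n → ix k ≤ ix j + 1 → Edge n (b j) (c k)
  cc   : ∀ {k m} → ix k < ix m → Edge n (c k) (c m)
  ac   : ∀ {i k} → ix i ≡ 3 → ix k ≡ n ∸ 1 → Edge n (a i) (c k)
  a₂d  : ∀ {i} → ix i ≡ 2 → Edge n (a i) d
  bd₁  : ∀ {j} → parity n ≡ 1ℙ → 2 ≤ ix j → ix j ≤ n ∸ 1 → Edge n (b j) d
  bd₀  : ∀ {j} → parity n ≡ 0ℙ → 2 ≤ ix j → ix j ≤ n ∸ 3 → Edge n (b j) d
  a₁d₀ : ∀ {i} → parity n ≡ 0ℙ → ix i ≡ 1 → Edge n (a i) d
  bd₀′ : ∀ {j} → parity n ≡ 0ℙ → ix j ≡ n + 1 → Edge n (b j) d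

private
  edge? : ∀ {n} → Decidable₂ (Edge n)
  edge? (a i) (b j) = map′ ab (λ { (ab p) → p }) (ix i ℕ.≤? ix j)
  edge? {n} (a i) (c k) = map′ (uncurry ac) (λ { (ac p q) → p , q }) (ix i ℕ.≟ 3 ×-dec ix k ℕ.≟ n ∸ 1)
  edge? {n} (a i) d = map′ [ a₂d , uncurry a₁d₀ ]′ (λ { (a₂d p) → inj₁ p ; (a₁d₀ p q) → inj₂ (p , q) })
    (ix i ℕ.≟ 2 ⊎-dec (parity n ℙ.≟ 0ℙ ×-dec ix i ℕ.≟ 1))
  edge? (b j) (b l) = map′ bb (λ { (bb p) → p }) (ix j ℕ.<? ix l)
  edge? {n} (b j) (c k) = map′ (uncurry bc) (λ { (bc p q) → p , q }) (ix j ℕ.≤? n ×-dec ix k ℕ.≤? ix j + 1)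
  edge? {n} (b j) d = map′
    [ (λ (p , q , r) → bd₁ p q r) , [ (λ (p , q , r) → bd₀ p q r) , uncurry bd₀′ ]′ ]′
    (λ { (bd₁ p q r) → inj₁ (p , q , r) ; (bd₀ p q r) → inj₂ (inj₁ (p , q , r)) ; (bd₀′ p q) → inj₂ (inj₂ (p , q)) })
    ((parity n ℙ.≟ 1ℙ ×-dec 2 ℕ.≤? ix j ×-dec ix j ℕ.≤? n ∸ 1) ⊎-dec
     (parity n ℙ.≟ 0ℙ ×-dec 2 ℕ.≤? ix j ×-dec ix j ℕ.≤? n ∸ 3) ⊎-dec
     (parity n ℙ.≟ 0ℙ ×-dec ix j ℕ.≟ n + 1))
  edge? (c k) (c m) = map′ cc (λ { (cc p) → p }) (ix k ℕ.<? ix m)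
  edge? (a _) (a _) = no λ ()
  edge? (b _) (a _) = no λ ()
  edge? (c _) (a _) = no λ ()
  edge? (c _) (b _) = no λ ()
  edge? (c _) d     = no λ ()
  edge? d     _     = no λ ()

  edge-irrefl : ∀ {n} {v : V n} → ¬ Edge n v v
  edge-irrefl (bb p) = ℕ.<-irrefl refl p
  edge-irrefl (cc p) = ℕ.<-irrefl refl p

  finite-V : ∀ n → Finite (setoid (V n))
  finite-V n = 3 + (suc n + (n ∸ 1 + 1)) ,
    (↔-sym +↔⊎ ↔-∘ ((Id.↔-id _ ⊎-↔ (↔-sym +↔⊎ ↔-∘ (Id.↔-id _ ⊎-↔ (↔-sym +↔⊎ ↔-∘ (Id.↔-id _ ⊎-↔ ↔-sym 1↔⊤))))) ↔-∘ sums))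
    where
      sums : V n ↔ (Fin 3 ⊎ Fin (suc n) ⊎ Fin (n ∸ 1) ⊎ ⊤)
      sums = mk↔ₛ′
        (λ { (a i) → inj₁ i ; (b j) → inj₂ (inj₁ j) ; (c k) → inj₂ (inj₂ (inj₁ k)) ; d → inj₂ (inj₂ (inj₂ tt)) })
        [ a , [ b , [ c , (λ _ → d) ]′ ]′ ]′
        (λ { (inj₁ _) → refl ; (inj₂ (inj₁ _)) → refl ; (inj₂ (inj₂ (inj₁ _))) → refl ; (inj₂ (inj₂ (inj₂ _))) → refl })
        (λ { (a _) → refl ; (b _) → refl ; (c _) → refl ; d → refl })

G : ℕ → FiniteGraph
G n = record
  { graph = record
    { Vertex     = V n
    ; Adj        = SymClosure (Edge n)
    ; Adj-sym    = symmetric (Edge n)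
    ; Adj-irrefl = λ { refl (fwd e) → edge-irrefl e ; refl (bwd e) → edge-irrefl e }
    }
  ; finite-vertices = finite-V n
  ; adj?            = λ u v → map′ [ fwd , bwd ]′ (λ { (fwd e) → inj₁ e ; (bwd e) → inj₂ e }) (edge? u v ⊎-dec edge? v u)
  }

{-# OPTIONS --safe #-}
-- The vertices c₁ and c₂ are twins: each is joined to b₁,…,bₙ, to every other c,
-- and (as n ≥ 4) to nothing else. Exchanging them is an automorphism of G, and
-- isomorphisms preserve F-degrees, so c₁ and c₂ have the same Kₙ-degree.
module Submission where

open import Defs
open import Data.Bool using (T)
open import Data.Bool.Properties using (T-irrelevant)
open import Data.Fin using (zero; suc)
open import Data.Fin.Permutation using (↔⇒≡)
open import Data.Nat using (ℕ; _≥_; _+_; s≤s; z≤n)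
open import Data.Nat.Properties using (m≤n+m; ≤-trans)
open import Data.Product using (_,_; proj₁)
open import Data.Sum using (_⊎_; inj₁; inj₂)
open import Function using (id; Inverse; mk↔ₛ′; mk⇔; Equivalence)
open import Function.Construct.Composition using (_⇔-∘_; _↔-∘_; inverse)
open import Function.Construct.Symmetry using (⇔-sym; ↔-sym) renaming (inverse to inverse-sym)
open import Relation.Binary.Construct.Closure.Symmetric using (SymClosure; fwd; bwd; symmetric)
open import Relation.Binary.PropositionalEquality
  using (_≡_; _≢_; refl; sym; trans; cong; cong₂; subst; subst₂)
open import Relation.Nullary using (¬_)

open Subgraph using (asGraph)

-- `degree` is read off one particular enumeration, the one built by `copies-finite`. Composing both
-- enumerations with the bijection yields a bijection between two `Fin`s, so the choice of
-- enumeration does not matter.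
cardinality-≡ : ∀ {S R} → Inverse S R → (p : Finite S) (q : Finite R) → proj₁ p ≡ proj₁ q
cardinality-≡ i (_ , p) (_ , q) = ↔⇒≡ (inverse (inverse (inverse-sym p) i) q)

≅-sym : ∀ {G H} → G ≅ H → H ≅ G
≅-sym {G} {H} φ = record
  { bijection = ↔-sym bijection
  ; adj-iff   = λ u v → ⇔-sym (mk⇔
      (λ e → subst₂ (Graph.Adj H) (strictlyInverseˡ u) (strictlyInverseˡ v)
        (Equivalence.to (adj-iff (from u) (from v)) e))
      (λ e → Equivalence.from (adj-iff (from u) (from v))
        (subst₂ (Graph.Adj H) (sym (strictlyInverseˡ u)) (sym (strictlyInverseˡ v)) e)))
  }
  where
    open _≅_ φ
    open Inverse bijection

≅-trans : ∀ {G H K} → G ≅ H → H ≅ K → G ≅ K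
≅-trans φ ψ = record
  { bijection = _≅_.bijection ψ ↔-∘ _≅_.bijection φ
  ; adj-iff   = λ u v → _≅_.adj-iff ψ _ _ ⇔-∘ _≅_.adj-iff φ u v
  }

module _ {G H : Graph} (φ : G ≅ H) where
  open _≅_ φ
  open Inverse bijection using (to; from; strictlyInverseˡ; strictlyInverseʳ)

  -- Membership is Boolean-valued, so it transports contravariantly by mere precomposition with
  -- `to`; an image would need `from`.
  pullback : Subgraph H → Subgraph G
  pullback K = record
    { inV     = λ v → inV (to v)
    ; inE     = λ u v → inE (to u) (to v)
    ; inE-sym = λ u v → inE-sym (to u) (to v)
    ; inE-Adj = λ u v e → Equivalence.from (adj-iff u v) (inE-Adj (to u) (to v) e)
    ; inE-inV = λ u v → inE-inV (to u) (to v)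
    }
    where open Subgraph K hiding (asGraph)

  -- The restriction of `to` works: edges of the pullback are by definition edges of `K` between the
  -- images.
  pullback-≅ : ∀ K → asGraph (pullback K) ≅ asGraph K
  pullback-≅ K = record
    { bijection = mk↔ₛ′
        (λ (v , t) → to v , t)
        (λ (v , t) → from v , subst (λ w → T (inV w)) (sym (strictlyInverseˡ v)) t)
        (λ (v , _) → ext (strictlyInverseˡ v))
        (λ (v , _) → ext′ (strictlyInverseʳ v))
    ; adj-iff = λ _ _ → mk⇔ id id
    }
    where
      open Subgraph K using (inV)
      ext : ∀ {x y s t} → x ≡ y → _≡_ {A = Graph.Vertex (asGraph K)} (x , s) (y , t)
      ext refl = cong (_ ,_) (T-irrelevant _ _)
      ext′ : ∀ {x y s t} → x ≡ y → _≡_ {A = Graph.Vertex (asGraph (pullback K))} (x , s) (y , t)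
      ext′ refl = cong (_ ,_) (T-irrelevant _ _)

copiesThrough-≅ : ∀ F {G H} (φ : G ≅ H) v →
  Inverse (copiesThrough F G v) (copiesThrough F H (Inverse.to (_≅_.bijection φ) v))
copiesThrough-≅ F φ v = record
  { to        = λ (K , t , i) → pullback (≅-sym φ) K ,
      subst (λ w → T (Subgraph.inV K w)) (sym (strictlyInverseʳ v)) t ,
      ≅-trans (pullback-≅ (≅-sym φ) K) i
  ; from      = λ (K , t , i) → pullback φ K , t , ≅-trans (pullback-≅ φ K) i
  ; to-cong   = λ (p , q) → (λ _ → p _) , (λ _ _ → q _ _)
  ; from-cong = λ (p , q) → (λ _ → p _) , (λ _ _ → q _ _)
  ; inverse   =
      -- Pulling back along `φ` and along its inverse precomposes with `to ∘ from` or `from ∘ to`,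
      -- which are the identity only pointwise.
      (λ {(K , _)} (p , q) →
        (λ w → trans (p (from w)) (cong (Subgraph.inV K) (strictlyInverseˡ w))) ,
        (λ u w → trans (q (from u) (from w))
          (cong₂ (Subgraph.inE K) (strictlyInverseˡ u) (strictlyInverseˡ w)))) ,
      (λ {(K , _)} (p , q) →
        (λ w → trans (p (to w)) (cong (Subgraph.inV K) (strictlyInverseʳ w))) ,
        (λ u w → trans (q (to u) (to w))
          (cong₂ (Subgraph.inE K) (strictlyInverseʳ u) (strictlyInverseʳ w))))
  }
  where open Inverse (_≅_.bijection φ) using (to; from; strictlyInverseˡ; strictlyInverseʳ)

degree-≅ : ∀ F G H (φ : FiniteGraph.graph G ≅ FiniteGraph.graph H) v →
  degree F G v ≡ degree F H (Inverse.to (_≅_.bijection φ) v)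
degree-≅ F G H φ v = cardinality-≡ (copiesThrough-≅ (FiniteGraph.graph F) φ v)
  (copies-finite F G v) (copies-finite F H (Inverse.to (_≅_.bijection φ) v))

-- Stated for arbitrary graphs because degree F (G n), when n is a literal or a
-- successor, must never be evaluated during conversion checking.
automorphism⇒¬irregular : ∀ F G (φ : FiniteGraph.graph G ≅ FiniteGraph.graph G) v →
  v ≢ Inverse.to (_≅_.bijection φ) v → ¬ Irregular F G
automorphism⇒¬irregular F G φ v moved irregular = irregular v _ moved (degree-≅ F G G φ v)

-- Preservation of adjacency already gives reflection: apply it to `σ u` and `σ v`, then cancel with
-- `σσ`.
involution-≅ : ∀ {G} (σ : Graph.Vertex G → Graph.Vertex G) → (∀ v → σ (σ v) ≡ v) →
  (∀ {u v} → Graph.Adj G u v → Graph.Adj G (σ u) (σ v)) → G ≅ G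
involution-≅ {G} σ σσ adj = record
  { bijection = mk↔ₛ′ σ σ σσ σσ
  ; adj-iff   = λ u v → mk⇔ adj (λ e → subst₂ (Graph.Adj G) (σσ u) (σσ v) (adj e))
  }

module _ {m : ℕ} where

  swap-c₁c₂ : V (4 + m) → V (4 + m)
  swap-c₁c₂ (c zero)       = c (suc zero)
  swap-c₁c₂ (c (suc zero)) = c zero
  swap-c₁c₂ v              = v

  swap-involutive : ∀ v → swap-c₁c₂ (swap-c₁c₂ v) ≡ v
  swap-involutive (a _)             = refl
  swap-involutive (b _)             = refl
  swap-involutive (c zero)          = refl
  swap-involutive (c (suc zero))    = refl
  swap-involutive (c (suc (suc _))) = refl
  swap-involutive d                 = refl

  -- The symmetric closure is required because `Edge` lists c₁c₂ in one orientation only, and the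
  -- swap reverses it.
  swap-edge : ∀ {u v} → Edge (4 + m) u v → SymClosure (Edge (4 + m)) (swap-c₁c₂ u) (swap-c₁c₂ v)
  swap-edge (ab p)                          = fwd (ab p)
  swap-edge (bb p)                          = fwd (bb p)
  -- As `ix j ≥ 1`, the bound `ix j + 1` is at least 2, so it admits both c₁ and c₂ for every `j`.
  swap-edge (bc {k = zero} p _)             = fwd (bc p (s≤s (m≤n+m 1 _)))
  swap-edge (bc {k = suc zero} p _)         = fwd (bc p (s≤s z≤n))
  swap-edge (bc {k = suc (suc _)} p q)      = fwd (bc p q)
  swap-edge (cc {zero} {zero} (s≤s ()))
  swap-edge (cc {zero} {suc zero} p)        = bwd (cc p)
  swap-edge (cc {zero} {suc (suc _)} p)     = fwd (cc (s≤s (s≤s (s≤s z≤n))))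
  swap-edge (cc {suc zero} {zero} (s≤s ()))
  swap-edge (cc {suc zero} {suc zero} (s≤s (s≤s ())))
  swap-edge (cc {suc zero} {suc (suc _)} p) = fwd (cc (s≤s (s≤s z≤n)))
  swap-edge (cc {suc (suc _)} {zero} (s≤s ()))
  swap-edge (cc {suc (suc _)} {suc zero} (s≤s (s≤s ())))
  swap-edge (cc {suc (suc _)} {suc (suc _)} p) = fwd (cc p)
  -- Here `ix k ≡ 3 + m`, so the c-end of this edge is neither c₁ nor c₂; the other two cases are
  -- refuted by unification.
  swap-edge (ac {k = suc (suc _)} p q)      = fwd (ac p q)
  swap-edge (a₂d p)                         = fwd (a₂d p)
  swap-edge (bd₁ p q r)                     = fwd (bd₁ p q r)
  swap-edge (bd₀ p q r)                     = fwd (bd₀ p q r)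
  swap-edge (a₁d₀ p q)                      = fwd (a₁d₀ p q)
  swap-edge (bd₀′ p q)                      = fwd (bd₀′ p q)

  swap-adj : ∀ {u v} → SymClosure (Edge (4 + m)) u v →
    SymClosure (Edge (4 + m)) (swap-c₁c₂ u) (swap-c₁c₂ v)
  swap-adj (fwd e) = swap-edge e
  swap-adj (bwd e) = symmetric (Edge (4 + m)) (swap-edge e)

G-not-irregular : ∀ F n → n ≥ 4 → ¬ Irregular F (G n)
-- Four `s≤s` expose `n` as `4 + m`, the form on which the swap is defined.
G-not-irregular F n (s≤s (s≤s (s≤s (s≤s _)))) = automorphism⇒¬irregular F (G n)
  (involution-≅ swap-c₁c₂ swap-involutive swap-adj) (c zero) (λ ())

mainTheorem1 : ∀ (n : ℕ) → n ≡ 5 ⊎ n ≥ 7 → ¬ Irregular (K n) (G n)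
mainTheorem1 n (inj₁ refl) = G-not-irregular (K n) n (m≤n+m 4 1)
mainTheorem1 n (inj₂ n≥7)  = G-not-irregular (K n) n (≤-trans (m≤n+m 4 3) n≥7)
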